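{- Let $b,c\in\mathbb{N}$ with $1\leqslant b\leqslant c$. If $3\nmid(1+b+c)$ and $\gcd(1+b+c,\,c^2-b)>1$, then there exists a semi-regular tournament on $n\in(1+b+c)\mathbb{N}$ vertices that does not contain a $D_{1,b,c}$-factor.
   Context: $\delta^0(G)$ is the minimum of all in-degrees and out-degrees of vertices of a digraph $G$. A tournament $G$ on $n$ vertices is semi-regular if $\delta^0(G)=\lfloor (n-1)/2\rfloor$. $TT_k$ is the transitive tournament on $k$ vertices. $D_{a,b,c}$ is the tournament on $a+b+c$ vertices obtained from the directed triangle $C_3$ by replacing its vertices with $TT_a,TT_b,TT_c$, respectively, with all edges directed from $TT_a$ to $TT_b$, from $TT_b$ to $TT_c$, and from $TT_c$ to $TT_a$; $D_{1,b,c}$ is the case $a=1$. An $H$-factor of $G$ is a family of pairwise vertex-disjoint copies of $H$ in $G$ covering all vertices of $G$. $(1+b+c)\mathbb{N}$ denotes the set of positive multiples of $1+b+c$. Convention: $\gcd(p,0)=p$ for every positive integer $p$. -}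

module Defs where

open import Data.Empty using (⊥)
open import Data.Fin using (Fin; _<_; _<?_)
open import Data.Fin.Properties using (<-irrefl)
open import Data.List using (_++_; allFin; filter; length; map)
open import Data.List.Extrema.Nat using (min)
open import Data.Nat using (ℕ; _∸_; ⌊_/2⌋)
open import Data.Product using (_×_; ∃₂)
open import Data.Sum using (_⊎_; inj₁; inj₂)
open import Data.Unit using (⊤; tt)
open import Function.Definitions using (Injective)
open import Level using (0ℓ)
open import Relation.Binary using (Rel; Decidable; Irreflexive; Trichotomous)
open import Relation.Binary.PropositionalEquality using (_≡_; _≢_; refl)
open import Relation.Nullary using (yes; no)

record Digraph (V : Set) : Set₁ where
  infix 4 _⟶_ _⟶?_
  field
    _⟶_    : Rel V 0ℓ
    _⟶?_   : Decidable _⟶_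
    irrefl : Irreflexive _≡_ _⟶_

-- Exactly one of u ⟶ v, u ≡ v, v ⟶ u holds.
IsTournament : ∀ {V} → Digraph V → Set
IsTournament G = Trichotomous _≡_ (Digraph._⟶_ G)

module _ {n : ℕ} (G : Digraph (Fin n)) where
  open Digraph G

  outDegree : Fin n → ℕ
  outDegree v = length (filter (λ w → v ⟶? w) (allFin n))

  inDegree : Fin n → ℕ
  inDegree v = length (filter (λ w → w ⟶? v) (allFin n))

  -- The starting value n exceeds every degree, so for n ≥ 1 it does not affect
  -- the minimum.
  δ⁰ : ℕ
  δ⁰ = min n (map inDegree (allFin n) ++ map outDegree (allFin n))

  IsSemiRegularTournament : Set
  IsSemiRegularTournament = IsTournament G × δ⁰ ≡ ⌊ n ∸ 1 /2⌋

TT : ∀ k → Digraph (Fin k)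
TT k = record { _⟶_ = _<_ ; _⟶?_ = _<?_ ; irrefl = <-irrefl }

-- The directed triangle with its vertices replaced by A, B, C: all edges go from
-- A to B, from B to C, and from C to A.
C₃[_,_,_] : ∀ {U V W} → Digraph U → Digraph V → Digraph W → Digraph (U ⊎ V ⊎ W)
C₃[_,_,_] {U} {V} {W} A B C = record { _⟶_ = E ; _⟶?_ = E? ; irrefl = E-irrefl }
  where
  module A = Digraph A
  module B = Digraph B
  module C = Digraph C

  pattern inA x = inj₁ x
  pattern inB y = inj₂ (inj₁ y)
  pattern inC z = inj₂ (inj₂ z)

  E : Rel (U ⊎ V ⊎ W) 0ℓ
  E (inA x) (inA x′) = x A.⟶ x′
  E (inB y) (inB y′) = y B.⟶ y′
  E (inC z) (inC z′) = z C.⟶ z′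
  E (inA _) (inB _)  = ⊤
  E (inB _) (inC _)  = ⊤
  E (inC _) (inA _)  = ⊤
  E (inB _) (inA _)  = ⊥
  E (inC _) (inB _)  = ⊥
  E (inA _) (inC _)  = ⊥

  E? : Decidable E
  E? (inA x) (inA x′) = x A.⟶? x′
  E? (inB y) (inB y′) = y B.⟶? y′
  E? (inC z) (inC z′) = z C.⟶? z′
  E? (inA _) (inB _)  = yes tt
  E? (inB _) (inC _)  = yes tt
  E? (inC _) (inA _)  = yes tt
  E? (inB _) (inA _)  = no λ ()
  E? (inC _) (inB _)  = no λ ()
  E? (inA _) (inC _)  = no λ ()

  E-irrefl : Irreflexive _≡_ E
  E-irrefl {inA _} refl = A.irrefl refl
  E-irrefl {inB _} refl = B.irrefl refl
  E-irrefl {inC _} refl = C.irrefl refl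

D : ∀ a b c → Digraph (Fin a ⊎ Fin b ⊎ Fin c)
D a b c = C₃[ TT a , TT b , TT c ]

-- A copy of H in G is a (not necessarily induced) subdigraph of G isomorphic to H,
-- given by an embedding of H onto it.
record Copy {V W : Set} (H : Digraph W) (G : Digraph V) : Set where
  private
    module H = Digraph H
    module G = Digraph G
  field
    embed     : W → V
    injective : Injective _≡_ _≡_ embed
    edges     : ∀ {x y} → x H.⟶ y → embed x G.⟶ embed y

record Factor {n : ℕ} {W : Set} (H : Digraph W) (G : Digraph (Fin n)) : Set where
  open Copy
  field
    size     : ℕ
    copy     : Fin size → Copy H G
    disjoint : ∀ {i j} → i ≢ j → ∀ x y → embed (copy i) x ≢ embed (copy j) y
    covers   : ∀ v → ∃₂ λ i x → embed (copy i) x ≡ v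

{-# OPTIONS --safe #-}
-- Let k = 1 + b + c and let d > 1 divide both k and c² − b. Blow up the directed
-- triangle with (semi-)regular tournaments on 2m + 2, 2m + 1 and 2m + 1 vertices;
-- the result is semi-regular of order 6m + 4, and k² ≡ 1 (mod 3) allows 6m + 4 = 4k².
-- Weight the vertices of the three parts by 1, b and c. As D 1 b c is strongly
-- connected, a copy of it either lies within one part, and has weight a multiple of
-- k, or meets the parts in its own blocks up to rotation, and has weight 1 + b² + c²
-- or b + bc + c. All of these are divisible by d, since b ≡ c² and 1 + c + c² ≡ 0
-- (mod d). But the total weight (2m + 1)k + 1 is not.
module Submission where

open import Data.Bool using (Bool; true; false; not; T; if_then_else_)
open import Data.Bool.Properties using (T?; not-involutive)
open import Data.Fin using (Fin; zero; suc; toℕ; _↑ˡ_; _↑ʳ_; combine; fromℕ<)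
open import Data.Fin.Patterns using (0F; 1F; 2F)
open import Data.Fin.Properties
  using (_≟_; +↔⊎; *↔×; splitAt-↑ˡ; splitAt-↑ʳ; remQuot-combine; toℕ≤pred[n])
open import Data.List using (filter; length; map; tabulate; allFin)
open import Data.List.Extrema.Nat using (min≈v⁺)
open import Data.List.Membership.Propositional.Properties using (∈-++⁺ʳ; ∈-map⁺; ∈-allFin)
open import Data.List.Relation.Unary.All.Properties using (++⁺; map⁺; tabulate⁺)
open import Data.Nat
  using (ℕ; zero; suc; _+_; _*_; _∸_; _^_; _≤_; _<_; z≤n; s≤s; ⌊_/2⌋; ⌈_/2⌉)
open import Data.Nat.DivMod using (_/_; _%_; m≡m%n+[m/n]*n; m%n<n)
open import Data.Nat.Divisibility
  using (_∣_; _∤_; divides; ∣1⇒≡1; ∣m∣n⇒∣m+n; ∣m+n∣m⇒∣n; ∣n⇒∣m*n; ∣m⇒∣m*n; _∣0;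
         m%n≡0⇒n∣m)
open import Data.Nat.GCD using (gcd; gcd[m,n]∣m; gcd[m,n]∣n)
open import Data.Nat.Properties hiding (_≟_)
open import Data.Nat.Tactic.RingSolver using (solve-∀)
open import Data.Product using (_×_; _,_; proj₁; proj₂; ∃-syntax; Σ-syntax; uncurry)
open import Data.Sum using (_⊎_; inj₁; inj₂)
open import Data.Sum.Function.Propositional using (_⊎-↔_)
open import Data.Product.Function.NonDependent.Propositional using (_×-↔_)
open import Data.Unit using (tt)
open import Function using (_∘_; id; _↔_; Injection; Inverse; mk⤖)
open import Function.Construct.Composition using (_↔-∘_)
open import Function.Construct.Identity using (↔-id)
open import Function.Consequences.Propositional using (strictlySurjective⇒surjective)
open import Function.Definitions using (Injective)
open import Function.Properties.Bijection using (⤖⇒↔)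
open import Function.Properties.Inverse using (Inverse⇒Injection)
open import Relation.Binary using (tri<; tri≈; tri>)
open import Relation.Binary.PropositionalEquality
open import Relation.Nullary using (¬_; yes; no; does)
open import Relation.Nullary.Negation using (contradiction)
open import Relation.Unary using (Decidable)
open import Algebra.Properties.CommutativeMonoid.Sum +-0-commutativeMonoid
  using (sum; sum-syntax; sum-cong-≗; sum-permute)
open import Defs

-- Sums over finite sets

∑-const : ∀ n x → ∑[ i < n ] x ≡ n * x
∑-const zero    x = refl
∑-const (suc n) x = cong (x +_) (∑-const n x)

∑-+ : ∀ m {n} (f : Fin (m + n) → ℕ) →
  sum f ≡ ∑[ i < m ] f (i ↑ˡ n) + ∑[ j < n ] f (m ↑ʳ j)
∑-+ zero    f = refl
∑-+ (suc m) f = trans (cong (f zero +_) (∑-+ m (f ∘ suc))) (sym (+-assoc (f zero) _ _))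

∑-∣ : ∀ {d} m {n} (f : Fin (m * n) → ℕ) →
  (∀ i → d ∣ ∑[ j < n ] f (combine {m} i j)) → d ∣ sum f
∑-∣ zero        f h = _ ∣0
∑-∣ (suc m) {n} f h = subst (_ ∣_) (sym (∑-+ n f))
  (∣m∣n⇒∣m+n (h zero) (∑-∣ m (λ i → f (n ↑ʳ i)) (h ∘ suc)))

module _ {a b c : ℕ} where

  ∑₃ : (Fin a ⊎ Fin b ⊎ Fin c → ℕ) → ℕ
  ∑₃ f = ∑[ i < a ] f (inj₁ i) + (∑[ j < b ] f (inj₂ (inj₁ j)) + ∑[ k < c ] f (inj₂ (inj₂ k)))

  -- Degrees and factors live on `Fin n`, the blown-up triangle on a disjoint sum. This bijection
  -- carries edges and sums from one to the other.
  blocks↔ : Fin (a + (b + c)) ↔ (Fin a ⊎ Fin b ⊎ Fin c)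
  blocks↔ = (↔-id _ ⊎-↔ +↔⊎) ↔-∘ +↔⊎

  blocks : Fin (a + (b + c)) → Fin a ⊎ Fin b ⊎ Fin c
  blocks = Inverse.to blocks↔

  blocks-injective : Injective _≡_ _≡_ blocks
  blocks-injective = Injection.injective (Inverse⇒Injection blocks↔)

  ∑-blocks : ∀ f → ∑[ i < a + (b + c) ] f (blocks i) ≡ ∑₃ f
  ∑-blocks f = trans (∑-+ a (f ∘ blocks)) (cong₂ _+_
    (sum-cong-≗ (cong f ∘ blocks-A))
    (trans (∑-+ b (λ i → f (blocks (a ↑ʳ i)))) (cong₂ _+_
      (sum-cong-≗ (cong f ∘ blocks-B)) (sum-cong-≗ (cong f ∘ blocks-C)))))
    where
    blocks-A : ∀ i → blocks (i ↑ˡ (b + c)) ≡ inj₁ i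
    blocks-A i rewrite splitAt-↑ˡ a i (b + c) = refl
    blocks-B : ∀ j → blocks (a ↑ʳ (j ↑ˡ c)) ≡ inj₂ (inj₁ j)
    blocks-B j rewrite splitAt-↑ʳ a (b + c) (j ↑ˡ c) | splitAt-↑ˡ b j c = refl
    blocks-C : ∀ k → blocks (a ↑ʳ (b ↑ʳ k)) ≡ inj₂ (inj₂ k)
    blocks-C k rewrite splitAt-↑ʳ a (b + c) (b ↑ʳ k) | splitAt-↑ʳ b c k = refl

-- Tournaments and degrees

⟦_⟧ : Bool → ℕ
⟦ b ⟧ = if b then 1 else 0

-- Degrees become sums of indicators, which split over the blocks. A general `f` is what the
-- induction requires; `allFin n` is the case `f = id`.
length-filter-tabulate : ∀ {A : Set} {P : A → Set} (P? : Decidable P) {n} (f : Fin n → A) →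
  length (filter P? (tabulate f)) ≡ ∑[ i < n ] ⟦ does (P? (f i)) ⟧
length-filter-tabulate P? {zero}  f = refl
length-filter-tabulate P? {suc n} f with does (P? (f zero))
... | true  = cong suc (length-filter-tabulate P? (f ∘ suc))
... | false = length-filter-tabulate P? (f ∘ suc)

pullback : ∀ {V W : Set} → (V → W) → Digraph W → Digraph V
pullback f G = record
  { _⟶_    = λ u v → f u ⟶ f v
  ; _⟶?_   = λ u v → f u ⟶? f v
  ; irrefl = λ u≡v → irrefl (cong f u≡v)
  }
  where open Digraph G

pullback-tournament : ∀ {V W : Set} {f : V → W} {G : Digraph W} →
  Injective _≡_ _≡_ f → IsTournament G → IsTournament (pullback f G)
pullback-tournament {f = f} inj tour u v with tour (f u) (f v)
... | tri< p q r = tri< p (q ∘ cong f) r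
... | tri≈ p q r = tri≈ p (inj q) r
... | tri> p q r = tri> p (q ∘ cong f) r

module _ {U V W : Set} {A : Digraph U} {B : Digraph V} {C : Digraph W} where

  C₃-tournament : IsTournament A → IsTournament B → IsTournament C →
    IsTournament C₃[ A , B , C ]
  C₃-tournament tA tB tC (inj₁ x) (inj₁ y) with tA x y
  ... | tri< p q r = tri< p (λ { refl → q refl }) r
  ... | tri≈ p refl r = tri≈ p refl r
  ... | tri> p q r = tri> p (λ { refl → q refl }) r
  C₃-tournament tA tB tC (inj₂ (inj₁ x)) (inj₂ (inj₁ y)) with tB x y
  ... | tri< p q r = tri< p (λ { refl → q refl }) r
  ... | tri≈ p refl r = tri≈ p refl r
  ... | tri> p q r = tri> p (λ { refl → q refl }) r
  C₃-tournament tA tB tC (inj₂ (inj₂ x)) (inj₂ (inj₂ y)) with tC x y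
  ... | tri< p q r = tri< p (λ { refl → q refl }) r
  ... | tri≈ p refl r = tri≈ p refl r
  ... | tri> p q r = tri> p (λ { refl → q refl }) r
  C₃-tournament tA tB tC (inj₁ _)        (inj₂ (inj₁ _)) = tri< tt (λ ()) (λ ())
  C₃-tournament tA tB tC (inj₂ (inj₁ _)) (inj₂ (inj₂ _)) = tri< tt (λ ()) (λ ())
  C₃-tournament tA tB tC (inj₂ (inj₂ _)) (inj₁ _)        = tri< tt (λ ()) (λ ())
  C₃-tournament tA tB tC (inj₂ (inj₁ _)) (inj₁ _)        = tri> (λ ()) (λ ()) tt
  C₃-tournament tA tB tC (inj₂ (inj₂ _)) (inj₂ (inj₁ _)) = tri> (λ ()) (λ ()) tt
  C₃-tournament tA tB tC (inj₁ _)        (inj₂ (inj₂ _)) = tri> (λ ()) (λ ()) tt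

-- The parity tournament

even : ℕ → Bool
even zero    = true
even (suc n) = not (even n)

-- For i < j there is an edge from i to j if j − i is odd, and from j to i otherwise.
parityEdge : ∀ {n} → Fin n → Fin n → Bool
parityEdge zero    zero    = false
parityEdge zero    (suc j) = even (toℕ j)
parityEdge (suc i) zero    = not (even (toℕ i))
parityEdge (suc i) (suc j) = parityEdge i j

parityEdge-irrefl : ∀ {n} (i : Fin n) → ¬ T (parityEdge i i)
parityEdge-irrefl (suc i) = parityEdge-irrefl i

Parity : ∀ n → Digraph (Fin n)
Parity n = record
  { _⟶_    = λ i j → T (parityEdge i j)
  ; _⟶?_   = λ i j → T? (parityEdge i j)
  ; irrefl = λ { {i} refl → parityEdge-irrefl i }
  }

Parity-tournament : ∀ n → IsTournament (Parity n)
Parity-tournament (suc n) zero zero = tri≈ (λ ()) refl (λ ())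
Parity-tournament (suc n) zero (suc j) with even (toℕ j)
... | true  = tri< tt (λ ()) (λ ())
... | false = tri> (λ ()) (λ ()) tt
Parity-tournament (suc n) (suc i) zero with even (toℕ i)
... | true  = tri> (λ ()) (λ ()) tt
... | false = tri< tt (λ ()) (λ ())
Parity-tournament (suc n) (suc i) (suc j) with Parity-tournament n i j
... | tri< p q r    = tri< p (λ { refl → q refl }) r
... | tri≈ p refl r = tri≈ p refl r
... | tri> p q r    = tri> p (λ { refl → q refl }) r

-- Dropping index 0 shifts every other index by one and swaps the parities, hence the mutual
-- recursion.
∑-even : ∀ n → ∑[ j < n ] ⟦ even (toℕ j) ⟧ ≡ ⌈ n /2⌉
∑-odd  : ∀ n → ∑[ j < n ] ⟦ not (even (toℕ j)) ⟧ ≡ ⌊ n /2⌋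
∑-even zero    = refl
∑-even (suc n) = cong suc (∑-odd n)
∑-odd zero    = refl
∑-odd (suc n) = trans
  (sum-cong-≗ {n} (λ j → cong ⟦_⟧ (not-involutive (even (toℕ j))))) (∑-even n)

⌊suc/2⌋ : ∀ n → ⌊ suc n /2⌋ ≡ ⟦ not (even n) ⟧ + ⌊ n /2⌋
⌊suc/2⌋ zero          = refl
⌊suc/2⌋ (suc zero)    = refl
⌊suc/2⌋ (suc (suc n)) rewrite not-involutive (even n) =
  trans (cong suc (⌊suc/2⌋ n)) (sym (+-suc _ _))

⌈suc/2⌉ : ∀ n → ⌈ suc n /2⌉ ≡ ⟦ even n ⟧ + ⌈ n /2⌉
⌈suc/2⌉ n rewrite ⌊suc/2⌋ n with even n
... | true  = refl
... | false = refl

outSum inSum : ∀ {n} → Fin n → ℕ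
outSum {n} i = ∑[ j < n ] ⟦ parityEdge i j ⟧
inSum  {n} i = ∑[ j < n ] ⟦ parityEdge j i ⟧

-- Out-neighbours of `i` are the earlier vertices at even distance, with distances in 1..i, and the
-- later ones at odd distance, with distances in 1..n-1-i. In-neighbours have the parities
-- exchanged.
outSum-≡ : ∀ {n} (i : Fin n) → outSum i ≡ ⌊ toℕ i /2⌋ + ⌈ n ∸ suc (toℕ i) /2⌉
outSum-≡ {suc n} zero    = ∑-even n
outSum-≡ {suc n} (suc i) = trans (cong (⟦ not (even (toℕ i)) ⟧ +_) (outSum-≡ i))
  (trans (sym (+-assoc ⟦ not (even (toℕ i)) ⟧ ⌊ toℕ i /2⌋ _))
    (cong (_+ ⌈ n ∸ suc (toℕ i) /2⌉) (sym (⌊suc/2⌋ (toℕ i)))))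

inSum-≡ : ∀ {n} (i : Fin n) → inSum i ≡ ⌈ toℕ i /2⌉ + ⌊ n ∸ suc (toℕ i) /2⌋
inSum-≡ {suc n} zero    = ∑-odd n
inSum-≡ {suc n} (suc i) = trans (cong (⟦ even (toℕ i) ⟧ +_) (inSum-≡ i))
  (trans (sym (+-assoc ⟦ even (toℕ i) ⟧ ⌈ toℕ i /2⌉ _))
    (cong (_+ ⌊ n ∸ suc (toℕ i) /2⌋) (sym (⌈suc/2⌉ (toℕ i)))))

⌊m+n/2⌋≤⌊m/2⌋+⌈n/2⌉ : ∀ m n → ⌊ m + n /2⌋ ≤ ⌊ m /2⌋ + ⌈ n /2⌉
⌊m+n/2⌋≤⌊m/2⌋+⌈n/2⌉ zero          n = ⌊n/2⌋≤⌈n/2⌉ n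
⌊m+n/2⌋≤⌊m/2⌋+⌈n/2⌉ (suc zero)    n = ≤-refl
⌊m+n/2⌋≤⌊m/2⌋+⌈n/2⌉ (suc (suc m)) n = s≤s (⌊m+n/2⌋≤⌊m/2⌋+⌈n/2⌉ m n)

-- The n other vertices split into i earlier and n - i later ones, and rounding one half up makes
-- good the rounding down of the other.
⌊n/2⌋≤outSum : ∀ {n} (i : Fin (suc n)) → ⌊ n /2⌋ ≤ outSum i
⌊n/2⌋≤outSum {n} i rewrite outSum-≡ i =
  subst (λ x → ⌊ x /2⌋ ≤ ⌊ toℕ i /2⌋ + ⌈ n ∸ toℕ i /2⌉) (m+[n∸m]≡n (toℕ≤pred[n] i))
    (⌊m+n/2⌋≤⌊m/2⌋+⌈n/2⌉ (toℕ i) (n ∸ toℕ i))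

⌊n/2⌋≤inSum : ∀ {n} (i : Fin (suc n)) → ⌊ n /2⌋ ≤ inSum i
-- Here the earlier vertices carry the ceiling, so the summands are swapped to reuse the same
-- inequality.
⌊n/2⌋≤inSum {n} i rewrite inSum-≡ i | +-comm ⌈ toℕ i /2⌉ ⌊ n ∸ toℕ i /2⌋ =
  subst (λ x → ⌊ x /2⌋ ≤ ⌊ n ∸ toℕ i /2⌋ + ⌈ toℕ i /2⌉) (m∸n+n≡m (toℕ≤pred[n] i))
    (⌊m+n/2⌋≤⌊m/2⌋+⌈n/2⌉ (n ∸ toℕ i) (toℕ i))

-- Semi-degrees of the blown-up triangle

∑-1 : ∀ n → ∑[ i < n ] 1 ≡ n
∑-1 n = trans (∑-const n 1) (*-identityʳ n)

∑-0 : ∀ n → ∑[ i < n ] 0 ≡ 0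
∑-0 n = trans (∑-const n 0) (*-zeroʳ n)

-- A lower bound for all degrees that one out-degree attains is their minimum; `k ≤ n` covers the
-- starting value of `min`.
δ⁰-attained : ∀ {n} (G : Digraph (Fin n)) {k v₀} → outDegree G v₀ ≡ k →
  (∀ v → k ≤ inDegree G v) → (∀ v → k ≤ outDegree G v) → k ≤ n → δ⁰ G ≡ k
δ⁰-attained G {v₀ = v₀} refl k≤in k≤out k≤n = min≈v⁺
  (∈-++⁺ʳ (map (inDegree G) (allFin _)) (∈-map⁺ (outDegree G) (∈-allFin v₀)))
  (++⁺ (map⁺ (tabulate⁺ k≤in)) (map⁺ (tabulate⁺ k≤out))) k≤n

module ParityBlowup (p q r : ℕ) where

  H : Digraph (Fin p ⊎ Fin q ⊎ Fin r)
  H = C₃[ Parity p , Parity q , Parity r ]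

  G : Digraph (Fin (p + (q + r)))
  G = pullback blocks H

  open Digraph H

  G-tournament : IsTournament G
  G-tournament = pullback-tournament {G = H} (blocks-injective {p} {q} {r})
    (C₃-tournament (Parity-tournament p) (Parity-tournament q) (Parity-tournament r))

  outH inH : Fin p ⊎ Fin q ⊎ Fin r → ℕ
  outH (inj₁ x)        = outSum x + q
  outH (inj₂ (inj₁ y)) = outSum y + r
  outH (inj₂ (inj₂ z)) = outSum z + p
  inH (inj₁ x)        = inSum x + r
  inH (inj₂ (inj₁ y)) = inSum y + p
  inH (inj₂ (inj₂ z)) = inSum z + q

  ∑₃-out : ∀ u → ∑₃ (λ w → ⟦ does (u ⟶? w) ⟧) ≡ outH u
  ∑₃-out (inj₁ x)        rewrite ∑-1 q | ∑-0 r = cong (outSum x +_) (+-identityʳ q)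
  ∑₃-out (inj₂ (inj₁ y)) rewrite ∑-0 p | ∑-1 r = refl
  ∑₃-out (inj₂ (inj₂ z)) rewrite ∑-1 p | ∑-0 q = +-comm p (outSum z)

  ∑₃-in : ∀ u → ∑₃ (λ w → ⟦ does (w ⟶? u) ⟧) ≡ inH u
  ∑₃-in (inj₁ x)        rewrite ∑-0 q | ∑-1 r = refl
  ∑₃-in (inj₂ (inj₁ y)) rewrite ∑-1 p | ∑-0 r =
    trans (cong (p +_) (+-identityʳ (inSum y))) (+-comm p (inSum y))
  ∑₃-in (inj₂ (inj₂ z)) rewrite ∑-0 p | ∑-1 q = +-comm q (inSum z)

  outDegree-G : ∀ v → outDegree G v ≡ outH (blocks v)
  outDegree-G v = trans (length-filter-tabulate (λ w → blocks v ⟶? blocks w) id)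
    (trans (∑-blocks (λ w → ⟦ does (blocks v ⟶? w) ⟧)) (∑₃-out (blocks v)))

  inDegree-G : ∀ v → inDegree G v ≡ inH (blocks v)
  inDegree-G v = trans (length-filter-tabulate (λ w → blocks w ⟶? blocks v) id)
    (trans (∑-blocks (λ w → ⟦ does (w ⟶? blocks v) ⟧)) (∑₃-in (blocks v)))

  δ⁰-G : ∀ {k} u₀ → outH u₀ ≡ k → (∀ u → k ≤ inH u) → (∀ u → k ≤ outH u) →
    k ≤ p + (q + r) → δ⁰ G ≡ k
  δ⁰-G u₀ out≡k k≤in k≤out = δ⁰-attained G
    (trans (outDegree-G (Inverse.from blocks↔ u₀))
      (trans (cong outH (Inverse.strictlyInverseˡ (blocks↔ {p} {q} {r}) u₀)) out≡k))
    (λ v → subst (_ ≤_) (sym (inDegree-G v)) (k≤in (blocks v)))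
    (λ v → subst (_ ≤_) (sym (outDegree-G v)) (k≤out (blocks v)))

module SemiRegular (m : ℕ) where

  p q : ℕ
  p = 2 + (m + m)
  q = 1 + (m + m)

  open ParityBlowup p q q using (outH; inH; G-tournament; δ⁰-G)

  order : ℕ
  order = p + (q + q)

  G : Digraph (Fin order)
  G = ParityBlowup.G p q q

  private
    m≤⌊p∸1/2⌋ : m ≤ ⌊ suc (m + m) /2⌋
    m≤⌊p∸1/2⌋ = ≤-reflexive (n≡⌈n+n/2⌉ m)

    m≤⌊q∸1/2⌋ : m ≤ ⌊ m + m /2⌋
    m≤⌊q∸1/2⌋ = ≤-reflexive (n≡⌊n+n/2⌋ m)

    q≤p : q ≤ p
    q≤p = n≤1+n q

  -- Each vertex has at least m neighbours of the required direction in its own part, and all of an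
  -- adjacent part, of size `q` or `p`. The bound m + q equals 3m + 1, half of 6m + 3 rounded down.
  m+q≤outH : ∀ u → m + q ≤ outH u
  m+q≤outH (inj₁ x)        = +-monoˡ-≤ q (≤-trans m≤⌊p∸1/2⌋ (⌊n/2⌋≤outSum x))
  m+q≤outH (inj₂ (inj₁ y)) = +-monoˡ-≤ q (≤-trans m≤⌊q∸1/2⌋ (⌊n/2⌋≤outSum y))
  m+q≤outH (inj₂ (inj₂ z)) = +-mono-≤ (≤-trans m≤⌊q∸1/2⌋ (⌊n/2⌋≤outSum z)) q≤p

  m+q≤inH : ∀ u → m + q ≤ inH u
  m+q≤inH (inj₁ x)        = +-monoˡ-≤ q (≤-trans m≤⌊p∸1/2⌋ (⌊n/2⌋≤inSum x))
  m+q≤inH (inj₂ (inj₁ y)) = +-mono-≤ (≤-trans m≤⌊q∸1/2⌋ (⌊n/2⌋≤inSum y)) q≤p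
  m+q≤inH (inj₂ (inj₂ z)) = +-monoˡ-≤ q (≤-trans m≤⌊q∸1/2⌋ (⌊n/2⌋≤inSum z))

  semiRegular : IsSemiRegularTournament G
  semiRegular = G-tournament , trans
    -- The first vertex of the second part attains the bound: it beats m vertices of its own part
    -- and the whole third part.
    (δ⁰-G (inj₂ (inj₁ zero)) (cong (_+ q) (trans (∑-even (m + m)) (sym (n≡⌈n+n/2⌉ m))))
      m+q≤inH m+q≤outH (+-mono-≤ (≤-trans (m≤m+n m m) (m≤n+m (m + m) 2)) (m≤m+n q q)))
    -- The order minus one is odd, namely 2(m + q) + 1.
    (trans (n≡⌈n+n/2⌉ (m + q)) (cong ⌊_/2⌋ (arith m)))
    where
    arith : ∀ m → suc (m + (1 + (m + m)) + (m + (1 + (m + m)))) ≡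
      suc (m + m) + (1 + (m + m) + (1 + (m + m)))
    arith = solve-∀

-- Copies of D 1 b c in a blown-up triangle

part : ∀ {U V W : Set} → U ⊎ V ⊎ W → Fin 3
part (inj₁ _)        = 0F
part (inj₂ (inj₁ _)) = 1F
part (inj₂ (inj₂ _)) = 2F

next : Fin 3 → Fin 3
next 0F = 1F
next 1F = 2F
next 2F = 0F

next-≢ : ∀ t → next t ≢ t
next-≢ 0F ()
next-≢ 1F ()
next-≢ 2F ()

next²-≢ : ∀ t → next (next t) ≢ t
next²-≢ 0F ()
next²-≢ 1F ()
next²-≢ 2F ()

Step : Fin 3 → Fin 3 → Set
Step t u = u ≡ t ⊎ u ≡ next t

edge⇒Step : ∀ {U V W} {A : Digraph U} {B : Digraph V} {C : Digraph W} x y →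
  Digraph._⟶_ C₃[ A , B , C ] x y → Step (part x) (part y)
edge⇒Step (inj₁ _)        (inj₁ _)        _ = inj₁ refl
edge⇒Step (inj₂ (inj₁ _)) (inj₂ (inj₁ _)) _ = inj₁ refl
edge⇒Step (inj₂ (inj₂ _)) (inj₂ (inj₂ _)) _ = inj₁ refl
edge⇒Step (inj₁ _)        (inj₂ (inj₁ _)) _ = inj₂ refl
edge⇒Step (inj₂ (inj₁ _)) (inj₂ (inj₂ _)) _ = inj₂ refl
edge⇒Step (inj₂ (inj₂ _)) (inj₁ _)        _ = inj₂ refl

Closed : Fin 3 → Fin 3 → Fin 3 → Set
Closed t u v = (u ≡ t × v ≡ t) ⊎ (u ≡ next t × v ≡ next (next t))

-- A closed walk of three steps advances a multiple of three times in the cycle of parts, so never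
-- or at every step.
Step⇒Closed : ∀ {t u v} → Step t u → Step u v → Step v t → Closed t u v
Step⇒Closed     (inj₁ refl) (inj₁ refl) _         = inj₁ (refl , refl)
Step⇒Closed     (inj₂ refl) (inj₂ refl) _         = inj₂ (refl , refl)
Step⇒Closed {t} (inj₁ refl) (inj₂ refl) (inj₁ eq) = contradiction (sym eq) (next-≢ t)
Step⇒Closed {t} (inj₁ refl) (inj₂ refl) (inj₂ eq) = contradiction (sym eq) (next²-≢ t)
Step⇒Closed {t} (inj₂ refl) (inj₁ refl) (inj₁ eq) = contradiction (sym eq) (next-≢ t)
Step⇒Closed {t} (inj₂ refl) (inj₁ refl) (inj₂ eq) = contradiction (sym eq) (next²-≢ t)

-- Two triangles sharing two vertices have their third vertices in the same part. This will confine
-- each block of a copy to a single part.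
Closed-uniqueᵘ : ∀ {t u u′ v} → Closed t u v → Closed t u′ v → u ≡ u′
Closed-uniqueᵘ     (inj₁ (refl , _)) (inj₁ (refl , _)) = refl
Closed-uniqueᵘ     (inj₂ (refl , _)) (inj₂ (refl , _)) = refl
Closed-uniqueᵘ {t} (inj₁ (_ , refl)) (inj₂ (_ , eq))   = contradiction (sym eq) (next²-≢ t)
Closed-uniqueᵘ {t} (inj₂ (_ , refl)) (inj₁ (_ , eq))   = contradiction eq (next²-≢ t)

Closed-uniqueᵛ : ∀ {t u v v′} → Closed t u v → Closed t u v′ → v ≡ v′
Closed-uniqueᵛ     (inj₁ (_ , refl)) (inj₁ (_ , refl)) = refl
Closed-uniqueᵛ     (inj₂ (_ , refl)) (inj₂ (_ , refl)) = refl
Closed-uniqueᵛ {t} (inj₁ (refl , _)) (inj₂ (eq , _))   = contradiction (sym eq) (next-≢ t)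
Closed-uniqueᵛ {t} (inj₂ (refl , _)) (inj₁ (eq , _))   = contradiction eq (next-≢ t)

module CopyWeights (b c : ℕ) (1≤b : 1 ≤ b) (b≤c : b ≤ c) where

  ω : Fin 3 → ℕ
  ω 0F = 1
  ω 1F = b
  ω 2F = c

  module _ {d : ℕ} (d∣k : d ∣ 1 + b + c) (d∣c²∸b : d ∣ c ^ 2 ∸ b) where

    -- It is the difference of the two multiples c(1 + b + c) and c² - b of d.
    d∣b+bc+c : d ∣ b + b * c + c
    d∣b+bc+c = ∣m+n∣m⇒∣n (subst (d ∣_) (sym eq) (∣n⇒∣m*n c d∣k)) d∣c²∸b
      where
      -- Ensures that the truncated subtraction in `c ^ 2 ∸ b` is a genuine one.
      b≤c² : b ≤ c ^ 2
      b≤c² = ≤-trans b≤c (≤-trans (≤-reflexive (sym (*-identityʳ c)))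
        (*-monoʳ-≤ c (≤-trans (≤-trans 1≤b b≤c) (≤-reflexive (sym (*-identityʳ c))))))
      shuffle : ∀ x b c → x + (b + b * c + c) ≡ (x + b) + (b * c + c)
      shuffle = solve-∀
      factor : ∀ b c → c * (c * 1) + (b * c + c) ≡ c * (1 + b + c)
      factor = solve-∀
      eq : (c ^ 2 ∸ b) + (b + b * c + c) ≡ c * (1 + b + c)
      eq = trans (shuffle (c ^ 2 ∸ b) b c)
        (trans (cong (_+ (b * c + c)) (m∸n+n≡m b≤c²)) (factor b c))

    d∣1+b²+c² : d ∣ 1 + b * b + c * c
    d∣1+b²+c² = ∣m+n∣m⇒∣n (subst (d ∣_) (square b c) (∣n⇒∣m*n (1 + b + c) d∣k))
      (∣n⇒∣m*n 2 d∣b+bc+c)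
      where
      square : ∀ b c → (1 + b + c) * (1 + b + c) ≡ 2 * (b + b * c + c) + (1 + b * b + c * c)
      square = solve-∀

    -- The sum is the weight of a copy whose blocks of sizes 1, b, c lie in parts t, u, v. Of the
    -- three rotations, the identity gives 1 + b² + c² and the other two give b + bc + c.
    Closed⇒∣ : ∀ t u v → Closed t u v → d ∣ ω t + b * ω u + c * ω v
    Closed⇒∣ t _ _ (inj₁ (refl , refl)) = subst (d ∣_) (distrib b c (ω t)) (∣m⇒∣m*n (ω t) d∣k)
      where
      distrib : ∀ b c x → (1 + b + c) * x ≡ x + b * x + c * x
      distrib = solve-∀
    Closed⇒∣ 0F _ _ (inj₂ (refl , refl)) = d∣1+b²+c²
    Closed⇒∣ 1F _ _ (inj₂ (refl , refl)) =
      subst (λ x → d ∣ b + b * c + x) (sym (*-identityʳ c)) d∣b+bc+c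
    Closed⇒∣ 2F _ _ (inj₂ (refl , refl)) = subst (d ∣_) (rotate b c) d∣b+bc+c
      where
      rotate : ∀ b c → b + b * c + c ≡ c + b * 1 + c * b
      rotate = solve-∀

    module _ {U V W V′ : Set} {A : Digraph U} {B : Digraph V} {C : Digraph W}
             (f : V′ → U ⊎ V ⊎ W) (κ : Copy (D 1 b c) (pullback f C₃[ A , B , C ])) where

      private
        π : Fin 1 ⊎ Fin b ⊎ Fin c → Fin 3
        π x = part (f (Copy.embed κ x))

        step : ∀ {x y} → Digraph._⟶_ (D 1 b c) x y → Step (π x) (π y)
        step {x} {y} x⟶y =
          edge⇒Step (f (Copy.embed κ x)) (f (Copy.embed κ y)) (Copy.edges κ x⟶y)

        closed : ∀ y z → Closed (π (inj₁ 0F)) (π (inj₂ (inj₁ y))) (π (inj₂ (inj₂ z)))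
        closed y z = Step⇒Closed
          (step {inj₁ 0F} {inj₂ (inj₁ y)} tt)
          (step {inj₂ (inj₁ y)} {inj₂ (inj₂ z)} tt)
          (step {inj₂ (inj₂ z)} {inj₁ 0F} tt)

        y₀ : Fin b
        y₀ = fromℕ< 1≤b

        z₀ : Fin c
        z₀ = fromℕ< (≤-trans 1≤b b≤c)

      -- Any `y` and `z` in the last two blocks form a directed triangle with the single vertex of
      -- the first. Comparing with the triangle through `y₀` and `z₀` shows that `π` is constant on
      -- each block, so the sum collapses to that of one triangle.
      copy-weight : d ∣ ∑₃ (ω ∘ π)
      copy-weight = subst (d ∣_) (sym eq) (Closed⇒∣ _ _ _ (closed y₀ z₀))
        where
        eq : ∑₃ (ω ∘ π) ≡
          ω (π (inj₁ 0F)) + b * ω (π (inj₂ (inj₁ y₀))) + c * ω (π (inj₂ (inj₂ z₀)))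
        eq = trans
          (cong₂ _+_ (+-identityʳ (ω (π (inj₁ 0F)))) (cong₂ _+_
            (trans (sum-cong-≗ λ y → cong ω (Closed-uniqueᵘ (closed y z₀) (closed y₀ z₀)))
              (∑-const b _))
            (trans (sum-cong-≗ λ z → cong ω (Closed-uniqueᵛ (closed y₀ z) (closed y₀ z₀)))
              (∑-const c _))))
          (sym (+-assoc (ω (π (inj₁ 0F))) _ _))

-- Weights summed over a factor

module _ {n a b c : ℕ} {H : Digraph (Fin a ⊎ Fin b ⊎ Fin c)} {G : Digraph (Fin n)}
         (F : Factor H G) where
  open Factor F
  open Copy

  -- A factor reindexes the vertex set by pairs of a copy and a vertex of `H`: disjointness and
  -- injectivity of the copies give injectivity, covering gives surjectivity.
  factor↔ : Fin (size * (a + (b + c))) ↔ Fin n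
  factor↔ = ⤖⇒↔ (mk⤖ (injective′ , strictlySurjective⇒surjective surjective′))
      ↔-∘ ((↔-id _ ×-↔ blocks↔) ↔-∘ *↔×)
    where
    injective′ : Injective _≡_ _≡_ (uncurry (embed ∘ copy))
    injective′ {i , x} {j , y} eq with i ≟ j
    ... | yes refl = cong (i ,_) (injective (copy i) eq)
    ... | no i≢j   = contradiction eq (disjoint i≢j x y)
    surjective′ : ∀ v → ∃[ ix ] uncurry (embed ∘ copy) ix ≡ v
    surjective′ v with covers v
    ... | i , x , eq = (i , x) , eq

  factor-sum-∣ : ∀ {d} (w : Fin n → ℕ) → (∀ i → d ∣ ∑₃ (w ∘ embed (copy i))) → d ∣ sum w
  factor-sum-∣ {d} w h = subst (d ∣_) (sym (sum-permute w factor↔)) (∑-∣ size _ λ i →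
    subst (d ∣_)
      (trans (sym (∑-blocks (w ∘ embed (copy i)))) (sum-cong-≗ λ j →
        sym (cong (λ ix → w (embed (copy (proj₁ ix)) (blocks (proj₂ ix)))) (remQuot-combine i j))))
      (h i))

-- The obstruction for arbitrary part sizes: the total weight of the blow-up is a sum of weights of
-- copies.
factor⇒∣ : ∀ {b c d p q r} → 1 ≤ b → b ≤ c → d ∣ 1 + b + c → d ∣ c ^ 2 ∸ b →
  Factor (D 1 b c) (ParityBlowup.G p q r) → d ∣ p * 1 + (q * b + r * c)
factor⇒∣ {b} {c} {d} {p} {q} {r} 1≤b b≤c d∣k d∣c²∸b F = subst (d ∣_)
  (trans (∑-blocks {p} {q} {r} (ω ∘ part))
    (cong₂ _+_ (∑-const p 1) (cong₂ _+_ (∑-const q b) (∑-const r c))))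
  (factor-sum-∣ F (ω ∘ part ∘ blocks {p} {q} {r})
    (λ i → copy-weight d∣k d∣c²∸b {A = Parity p} {Parity q} {Parity r}
      (blocks {p} {q} {r}) (Factor.copy F i)))
  where open CopyWeights b c 1≤b b≤c

-- Choice of the order and conclusion

square-mod-3 : ∀ k → 3 ∤ k → ∃[ q ] k * k ≡ 1 + q * 3
square-mod-3 k 3∤k with k % 3 in r | m%n<n k 3 | m≡m%n+[m/n]*n k 3
... | 0 | _ | _  = contradiction (m%n≡0⇒n∣m k 3 r) 3∤k
... | 1 | _ | eq = 2 * (k / 3) + 3 * (k / 3) * (k / 3) ,
  trans (cong (λ x → x * x) eq) (expand (k / 3))
  where
  expand : ∀ x → (1 + x * 3) * (1 + x * 3) ≡ 1 + (2 * x + 3 * x * x) * 3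
  expand = solve-∀
... | 2 | _ | eq = 1 + 4 * (k / 3) + 3 * (k / 3) * (k / 3) ,
  trans (cong (λ x → x * x) eq) (expand (k / 3))
  where
  expand : ∀ x → (2 + x * 3) * (2 + x * 3) ≡ 1 + (1 + 4 * x + 3 * x * x) * 3
  expand = solve-∀
... | suc (suc (suc _)) | s≤s (s≤s (s≤s ())) | _

module _ {b c d : ℕ} (1≤b : 1 ≤ b) (b≤c : b ≤ c) (1<d : 1 < d)
         (d∣k : d ∣ 1 + b + c) (d∣c²∸b : d ∣ c ^ 2 ∸ b) where

  -- Since `p` is 1 + q, the extra vertex of weight 1 leaves the total one above a multiple of 1 + b
  -- + c, and d would divide 1.
  noFactor : ∀ m → ¬ Factor (D 1 b c) (SemiRegular.G m)
  noFactor m F = <⇒≢ 1<d (sym (∣1⇒≡1 (∣m+n∣m⇒∣n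
    (subst (d ∣_) (weight q b c) (factor⇒∣ {p = p} {q} {q} 1≤b b≤c d∣k d∣c²∸b F))
    (∣n⇒∣m*n q d∣k))))
    where
    open SemiRegular m using (p; q)
    weight : ∀ q b c → (1 + q) * 1 + (q * b + q * c) ≡ q * (1 + b + c) + 1
    weight = solve-∀

  semiRegular-noFactor : ∀ m → 1 + b + c ∣ SemiRegular.order m →
    ∃[ n ] 1 ≤ n × (1 + b + c) ∣ n ×
    (Σ[ G ∈ Digraph (Fin n) ] IsSemiRegularTournament G × ¬ Factor (D 1 b c) G)
  semiRegular-noFactor m k∣n = SemiRegular.order m , s≤s z≤n , k∣n ,
    SemiRegular.G m , SemiRegular.semiRegular m , noFactor m

-- For m = 2t the order 6m + 4 is 4(1 + 3t), that is, 4k².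
∣order : ∀ k {t} → k * k ≡ 1 + t * 3 → k ∣ SemiRegular.order (2 * t)
∣order k {t} k²≡1+3t = divides (4 * k)
  (trans (expand t) (trans (cong (4 *_) (sym k²≡1+3t)) (sym (*-assoc 4 k k))))
  where
  expand : ∀ t → 2 + (2 * t + 2 * t) + (1 + (2 * t + 2 * t) + (1 + (2 * t + 2 * t))) ≡
    4 * (1 + t * 3)
  expand = solve-∀

proposition1p7 : ∀ (b c : ℕ) → 1 ≤ b → b ≤ c →
    3 ∤ (1 + b + c) → 1 < gcd (1 + b + c) (c ^ 2 ∸ b) →
    ∃[ n ] 1 ≤ n × (1 + b + c) ∣ n ×
    (Σ[ G ∈ Digraph (Fin n) ] IsSemiRegularTournament G × ¬ Factor (D 1 b c) G)
proposition1p7 b c 1≤b b≤c 3∤k 1<d = let t , k²≡1+3t = square-mod-3 (1 + b + c) 3∤k in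
  semiRegular-noFactor 1≤b b≤c 1<d
    (gcd[m,n]∣m (1 + b + c) (c ^ 2 ∸ b)) (gcd[m,n]∣n (1 + b + c) (c ^ 2 ∸ b))
    (2 * t) (∣order (1 + b + c) {t} k²≡1+3t)
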